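{- For every typing context $\Gamma$, formula $A$ and term $u$ such that $\Gamma\vdash_{\mathtt{NI}^2_{RP}}u:A$, one has $\Gamma\vdash_{\mathtt{NI}^2_{RP}}u\simeq_{\eta\varepsilon}u^{\downarrow^{\varepsilon}}:A$, where $u^{\downarrow^{\varepsilon}}$ is the $\varepsilon$-atomization of $u$.
   Context: Notation for lists: for a finite (possibly empty) list $\mathcal A=\langle a_1,\dots,a_n\rangle$, $\langle A_a\rangle_{a\in\mathcal A}\supset B$ abbreviates $A_{a_1}\supset\dots\supset A_{a_n}\supset B$ (just $B$ if $\mathcal A$ is empty); $\lambda\langle x_a\rangle_{a\in\mathcal A}.t$ abbreviates $\lambda x_{a_1}\dots\lambda x_{a_n}.t$ and $t\langle u_a\rangle_{a\in\mathcal A}$ abbreviates $t\,u_{a_1}\cdots u_{a_n}$. Index sets are omitted when clear. Formulas. $\mathcal L^2$: $A::=X\mid A\supset B\mid\forall X.A$, with $X$ ranging over propositional variables. A universal polynomial formula is one of the form $\forall X.\langle\langle A_{kj}\rangle_{j\in J_k}\supset X\rangle_{k\in\mathcal K}\supset X$, where $\mathcal K$ and all $J_k$ are finite lists and $X$ is not free in any $A_{kj}$. $\mathcal L^2_{RP}$ is the set of $\mathcal L^2$-formulas in which every subformula beginning with $\forall$ is universal polynomial (the $A_{kj}$ being themselves in $\mathcal L^2_{RP}$). System $\mathtt{NI}^2$ (System F over $\mathcal L^2$): terms $t::=x\mid\lambda x.t\mid tu\mid\Lambda X.t\mid tB$, with the usual rules: $\Gamma,x:A\vdash x:A$; from $\Gamma,x:A\vdash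 t:B$ infer $\Gamma\vdash\lambda x.t:A\supset B$; from $\Gamma\vdash t:A\supset B$ and $\Gamma\vdash u:A$ infer $\Gamma\vdash tu:B$; from $\Gamma\vdash t:A$ with $X\notin FV(\Gamma)$ infer $\Gamma\vdash\Lambda X.t:\forall X.A$; from $\Gamma\vdash t:\forall X.A$ infer $\Gamma\vdash tB:A\llbracket B/X\rrbracket$ ($B$ is the witness). $\mathtt{NI}^2_{RP}$ is the restriction of $\mathtt{NI}^2$ to $\mathcal L^2_{RP}$-formulas (in particular witnesses are in $\mathcal L^2_{RP}$). Terms represent natural deduction derivations; the type information of a derivation is regarded as part of the term, though not displayed, and the map below is defined by recursion on typing derivations. Contexts. A term context $\mathtt U$ is a term with a distinguished variable $[\ ]$ (the hole), occurring any finite number of times. $\mathtt U[t]$ is capture-avoiding substitution of $t$ for $[\ ]$; $\mathtt U\{t\}$ is variable-capturing substitution. $\mathtt U:A\vdash^\Gamma B$ means $\Gamma,x:A\vdash\mathtt U[x]:B$. Equational theory. $\Gamma\vdash_{\mathtt{NI}^2_{RP}}t\simeq_{\eta\varepsilon}s:A$ means that $t\simeq s$ is derivable at type $A$ in context $\Gamma$, within $\mathtt{NI}^2_{RP}$, by reflexivity, symmetry, transitivity, congruence and the rules: ($\supset\eta$) $t\simeq\lambda x.tx$ for $t:A\supset B$, $x\notin FV(t)$; ($\forall\eta$) $t\simeq\Lambda X.tX$ for $t:\forall X.A$, $X\notin FV(t)$; ($\varepsilon$) if $\Gamma\vdash t:\forall X.\langle\langle A_{kj}\rangle_{j\in J_k}\supset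 X\rangle_{k\in\mathcal K}\supset X$ (universal polynomial), $\Gamma\vdash u_k:\langle A_{kj}\rangle_{j\in J_k}\supset C$ for all $k\in\mathcal K$, and $\mathtt U:C\vdash^\Gamma D$, then $\mathtt U[\,t\,C\,\langle u_k\rangle_{k}]\simeq t\,D\,\langle\lambda\langle w_j\rangle_{j\in J_k}.\mathtt U[u_k\langle w_j\rangle]\rangle_{k}:D$, with the $w_j$ fresh. Weak expansion contexts. For $B\in\mathcal L^2$, $\mathsf{at}(B)$ is its rightmost variable. The contexts $\mathtt{El}_B$, $\mathtt{In}_B$ are defined with the same fresh variables in both: $\mathtt{El}_Z=\mathtt{In}_Z=[\ ]$ for a variable $Z$; $\mathtt{El}_{C\supset D}=\mathtt{El}_D[[\ ]x]$, $\mathtt{In}_{C\supset D}=\lambda x.\mathtt{In}_D$; $\mathtt{El}_{\forall X.D}=\mathtt{El}_D[[\ ]X]$, $\mathtt{In}_{\forall X.D}=\Lambda X.\mathtt{In}_D$. (If the rightmost variable is bound in $B$, then $\mathsf{at}(B)$ denotes the corresponding type variable used in $\mathtt{El}_B,\mathtt{In}_B$.) $\varepsilon$-atomization. For $u$ typable in $\mathtt{NI}^2_{RP}$: $x^{\downarrow^\varepsilon}=x$; $(\lambda x.t)^{\downarrow^\varepsilon}=\lambda x.t^{\downarrow^\varepsilon}$; $(ts)^{\downarrow^\varepsilon}=t^{\downarrow^\varepsilon}s^{\downarrow^\varepsilon}$; $(\Lambda X.t)^{\downarrow^\varepsilon}=\Lambda X.t^{\downarrow^\varepsilon}$; $(tY)^{\downarrow^\varepsilon}=t^{\downarrow^\varepsilon}Y$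 for $Y$ a variable; and for $B$ not atomic, $t:\forall X.\langle\langle A_{kj}\rangle_{j\in J_k}\supset X\rangle_{k\in\mathcal K}\supset X$ and $Z=\mathsf{at}(B)$: $$(tB)^{\downarrow^\varepsilon}=\lambda\langle y_k\rangle_{k\in\mathcal K}.\,\mathtt{In}_B\big\{\,t^{\downarrow^\varepsilon}Z\,\langle\lambda\langle w_j\rangle_{j\in J_k}.\mathtt{El}_B[y_k\langle w_j\rangle]\rangle_{k\in\mathcal K}\big\}.$$ -}

module Defs where

open import Data.Fin.Base using (Fin; zero; suc)
open import Data.List.Base using (List; []; _∷_; foldl; foldr; map; zipWith)
open import Data.List.Relation.Binary.Pointwise.Base using (Pointwise)
open import Data.List.Relation.Unary.All using (All)
open import Data.Nat.Base using (ℕ; suc)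
open import Data.Vec.Base as Vec using (Vec; _∷_; lookup)
open import Data.Vec.Functional using () renaming (_∷_ to _◂_)
import Data.Vec.Relation.Unary.All as VecAll
open import Function.Base using (_∘_; id)

private
  variable
    n n′ m m′ : ℕ

infixr 20 _⊃_ _⊃*_

-- L²-formulas whose free propositional variables are among n de Bruijn
-- indices.

data Ty (n : ℕ) : Set where
  tvar : Fin n → Ty n
  _⊃_  : Ty n → Ty n → Ty n
  ∀∙_  : Ty (suc n) → Ty n

lift : (Fin n → Fin n′) → Fin (suc n) → Fin (suc n′)
lift ρ = zero ◂ (suc ∘ ρ)

renᵗ : (Fin n → Fin n′) → Ty n → Ty n′
renᵗ ρ (tvar X) = tvar (ρ X)
renᵗ ρ (A ⊃ B)  = renᵗ ρ A ⊃ renᵗ ρ B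
renᵗ ρ (∀∙ A)   = ∀∙ renᵗ (lift ρ) A

subᵗ : (Fin n → Ty n′) → Ty n → Ty n′
subᵗ σ (tvar X) = σ X
subᵗ σ (A ⊃ B)  = subᵗ σ A ⊃ subᵗ σ B
subᵗ σ (∀∙ A)   = ∀∙ subᵗ (tvar zero ◂ (renᵗ suc ∘ σ)) A

_⟦_⟧ : Ty (suc n) → Ty n → Ty n
A ⟦ B ⟧ = subᵗ (B ◂ tvar) A

-- ⟨ A₁ , … , Aₙ ⟩ ⊃ B

_⊃*_ : List (Ty n) → Ty n → Ty n
As ⊃* B = foldr _⊃_ B As

-- ⟨⟨A_kj⟩_{j ∈ J_k}⟩_{k ∈ 𝒦}

Family : ℕ → Set
Family n = List (List (Ty n))

renᶠ : (Fin n → Fin n′) → Family n → Family n′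
renᶠ ρ = map (map (renᵗ ρ))

-- ⟨⟨A_kj⟩ⱼ ⊃ C⟩ₖ ⊃ C

matrix : Family n → Ty n → Ty n
matrix 𝒜 C = map (_⊃* C) 𝒜 ⊃* C

-- The A_kj live outside the scope of the quantifier and are weakened under
-- it, which expresses that X is not free in them.

univPoly : Family n → Ty n
univPoly 𝒜 = ∀∙ matrix (renᶠ suc 𝒜) (tvar zero)

data RP {n : ℕ} : Ty n → Set where
  tvar : ∀ X → RP (tvar X)
  _⊃_  : ∀ {A B} → RP A → RP B → RP (A ⊃ B)
  univ : ∀ {𝒜} → All (All RP) 𝒜 → RP (univPoly 𝒜)

-- Church-style terms with n type variables and m term variables.  The
-- annotation on λ together with the typing context determines all the type
-- information of a derivation.

data Tm (n m : ℕ) : Set where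
  var  : Fin m → Tm n m
  lam  : Ty n → Tm n (suc m) → Tm n m
  app  : Tm n m → Tm n m → Tm n m
  Lam  : Tm (suc n) m → Tm n m
  tapp : Tm n m → Ty n → Tm n m

tren : (Fin n → Fin n′) → Tm n m → Tm n′ m
tren ρ (var x)    = var x
tren ρ (lam A t)  = lam (renᵗ ρ A) (tren ρ t)
tren ρ (app t u)  = app (tren ρ t) (tren ρ u)
tren ρ (Lam t)    = Lam (tren (lift ρ) t)
tren ρ (tapp t B) = tapp (tren ρ t) (renᵗ ρ B)

ren : (Fin m → Fin m′) → Tm n m → Tm n m′
ren ρ (var x)    = var (ρ x)
ren ρ (lam A t)  = lam A (ren (lift ρ) t)
ren ρ (app t u)  = app (ren ρ t) (ren ρ u)
ren ρ (Lam t)    = Lam (ren ρ t)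
ren ρ (tapp t B) = tapp (ren ρ t) B

sub : (Fin m → Tm n m′) → Tm n m → Tm n m′
sub σ (var x)    = σ x
sub σ (lam A t)  = lam A (sub (var zero ◂ (ren suc ∘ σ)) t)
sub σ (app t u)  = app (sub σ t) (sub σ u)
sub σ (Lam t)    = Lam (sub (tren suc ∘ σ) t)
sub σ (tapp t B) = tapp (sub σ t) B

-- m ⊞ As is the scope reached from m by abstracting over variables of types
-- As in order, so that the last one is the innermost.

_⊞_ : ℕ → List (Ty n) → ℕ
m ⊞ []       = m
m ⊞ (A ∷ As) = suc m ⊞ As

weaken : (As : List (Ty n)) → Fin m → Fin (m ⊞ As)
weaken []       x = x
weaken (A ∷ As) x = weaken As (suc x)

fresh : (As : List (Ty n)) → List (Fin (m ⊞ As))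
fresh []       = []
fresh (A ∷ As) = weaken As zero ∷ fresh As

lam* : (As : List (Ty n)) → Tm n (m ⊞ As) → Tm n m
lam* []       t = t
lam* (A ∷ As) t = lam A (lam* As t)

app* : Tm n m → List (Tm n m) → Tm n m
app* = foldl app

-- A context U is a term whose variable zero is the hole.

TmCtx : ℕ → ℕ → Set
TmCtx n m = Tm n (suc m)

-- plug U ρ t is U[t], where t lives in an extension ρ of the scope of U.

plug : TmCtx n m → (Fin m → Fin m′) → Tm n m′ → Tm n m′
plug U ρ t = sub (t ◂ (var ∘ ρ)) U

_[_] : TmCtx n m → Tm n m → Tm n m
U [ t ] = plug U id t

-- ⟨ λ⟨w_j⟩ⱼ. U[u_k ⟨w_j⟩ⱼ] ⟩ₖ

inside : TmCtx n m → Family n → List (Tm n m) → List (Tm n m)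
inside U = zipWith λ As u →
  lam* As (plug U (weaken As) (app* (ren (weaken As) u) (map var (fresh As))))

Ctx : ℕ → ℕ → Set
Ctx n m = Vec (Ty n) m

infix 4 _⊢_∶_ _⊢_≃_∶_

-- The RP premises are placed so that every formula of a derivation,
-- including those of its contexts, is in L²_RP.

data _⊢_∶_ {n m : ℕ} (Γ : Ctx n m) : Tm n m → Ty n → Set where
  ⊢var  : VecAll.All RP Γ → (x : Fin m) → Γ ⊢ var x ∶ lookup Γ x
  ⊢lam  : ∀ {A B t} → RP A → A ∷ Γ ⊢ t ∶ B → Γ ⊢ lam A t ∶ A ⊃ B
  ⊢app  : ∀ {A B t u} → Γ ⊢ t ∶ A ⊃ B → Γ ⊢ u ∶ A → Γ ⊢ app t u ∶ B
  ⊢Lam  : ∀ {A t} → RP (∀∙ A) → Vec.map (renᵗ suc) Γ ⊢ t ∶ A →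
          Γ ⊢ Lam t ∶ ∀∙ A
  ⊢tapp : ∀ {A B t} → RP (∀∙ A) → RP B → Γ ⊢ t ∶ ∀∙ A →
          Γ ⊢ tapp t B ∶ A ⟦ B ⟧

data _⊢_≃_∶_ {n m : ℕ} (Γ : Ctx n m) : Tm n m → Tm n m → Ty n → Set where
  ≃-refl  : ∀ {A t} → Γ ⊢ t ∶ A → Γ ⊢ t ≃ t ∶ A
  ≃-sym   : ∀ {A t s} → Γ ⊢ t ≃ s ∶ A → Γ ⊢ s ≃ t ∶ A
  ≃-trans : ∀ {A t s r} → Γ ⊢ t ≃ s ∶ A → Γ ⊢ s ≃ r ∶ A → Γ ⊢ t ≃ r ∶ A
  ≃-lam   : ∀ {A B t s} → RP A → A ∷ Γ ⊢ t ≃ s ∶ B →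
            Γ ⊢ lam A t ≃ lam A s ∶ A ⊃ B
  ≃-app   : ∀ {A B t s u v} → Γ ⊢ t ≃ s ∶ A ⊃ B → Γ ⊢ u ≃ v ∶ A →
            Γ ⊢ app t u ≃ app s v ∶ B
  ≃-Lam   : ∀ {A t s} → RP (∀∙ A) → Vec.map (renᵗ suc) Γ ⊢ t ≃ s ∶ A →
            Γ ⊢ Lam t ≃ Lam s ∶ ∀∙ A
  ≃-tapp  : ∀ {A B t s} → RP (∀∙ A) → RP B → Γ ⊢ t ≃ s ∶ ∀∙ A →
            Γ ⊢ tapp t B ≃ tapp s B ∶ A ⟦ B ⟧
  ⊃η      : ∀ {A B t} → Γ ⊢ t ∶ A ⊃ B →
            Γ ⊢ t ≃ lam A (app (ren suc t) (var zero)) ∶ A ⊃ B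
  ∀η      : ∀ {A t} → Γ ⊢ t ∶ ∀∙ A →
            Γ ⊢ t ≃ Lam (tapp (tren suc t) (tvar zero)) ∶ ∀∙ A
  ε       : ∀ {𝒜 C D t us U} → RP C → RP D →
            Γ ⊢ t ∶ univPoly 𝒜 →
            Pointwise (λ As u → Γ ⊢ u ∶ As ⊃* C) 𝒜 us →
            C ∷ Γ ⊢ U ∶ D →
            Γ ⊢ U [ app* (tapp t C) us ] ≃ app* (tapp t D) (inside U 𝒜 us) ∶ D

-- The scopes reached inside In_B: the fresh type (resp. term) variables
-- it binds, on top of n (resp. m).

tscope : Ty n → ℕ
tscope {n} (tvar Z) = n
tscope (C ⊃ D)      = tscope D
tscope (∀∙ D)       = tscope D

scope : Ty n → ℕ → ℕ
scope (tvar Z) m = m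
scope (C ⊃ D)  m = scope D (suc m)
scope (∀∙ D)   m = scope D m

into-tscope : (B : Ty n) → Fin n → Fin (tscope B)
into-tscope (tvar Z) X = X
into-tscope (C ⊃ D)  X = into-tscope D X
into-tscope (∀∙ D)   X = into-tscope D (suc X)

into-scope : (B : Ty n) → Fin m → Fin (scope B m)
into-scope (tvar Z) x = x
into-scope (C ⊃ D)  x = into-scope D (suc x)
into-scope (∀∙ D)   x = into-scope D x

at : (B : Ty n) → Fin (tscope B)
at (tvar Z) = Z
at (C ⊃ D)  = at D
at (∀∙ D)   = at D

-- The hole of El_B ranges over terms in the scope of the fresh variables.

El : (B : Ty n) → TmCtx (tscope B) (scope B m)
El (tvar Z) = var zero
El (C ⊃ D)  = plug (El D) suc (app (var zero) (var (suc (into-scope D zero))))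
El (∀∙ D)   = plug (El D) suc (tapp (var zero) (tvar (into-tscope D zero)))

-- In B t is the variable-capturing In_B{t}.

In : (B : Ty n) → Tm (tscope B) (scope B m) → Tm n m
In (tvar Z) t = t
In (C ⊃ D)  t = lam C (In D t)
In (∀∙ D)   t = Lam (In D t)

-- λ⟨y_k⟩ₖ. In_B{ t Z ⟨λ⟨w_j⟩ⱼ. El_B[y_k ⟨w_j⟩ⱼ]⟩ₖ } with Z = at(B), where t and
-- the A_kj are weakened past the fresh variables.

expand : Family n → Tm n m → Ty n → Tm n m
expand 𝒜 t B =
  lam* Ys (In B (app* (tapp t′ (tvar (at B)))
                      (inside (El B) (renᶠ (into-tscope B) 𝒜) ys)))
  where
  Ys = map (_⊃* B) 𝒜
  ys = map (var ∘ into-scope B) (fresh Ys)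
  t′ = ren (into-scope B ∘ weaken Ys) (tren (into-tscope B) t)

instantiate : Family n → Tm n m → Ty n → Tm n m
instantiate 𝒜 t (tvar Y)  = tapp t (tvar Y)
instantiate 𝒜 t B@(_ ⊃ _) = expand 𝒜 t B
instantiate 𝒜 t B@(∀∙ _)  = expand 𝒜 t B

infix 30 _↓ᵋ

_↓ᵋ : {Γ : Ctx n m} {u : Tm n m} {A : Ty n} → Γ ⊢ u ∶ A → Tm n m
⊢var _ x ↓ᵋ                        = var x
⊢lam {A = A} _ d ↓ᵋ                = lam A (d ↓ᵋ)
⊢app d e ↓ᵋ                        = app (d ↓ᵋ) (e ↓ᵋ)
⊢Lam _ d ↓ᵋ                        = Lam (d ↓ᵋ)
⊢tapp {B = B} (univ {𝒜} _) _ d ↓ᵋ = instantiate 𝒜 (d ↓ᵋ) B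

{-# OPTIONS --safe #-}
module Submission where

-- Why the theorem holds. Everything reduces to one instance: if s has the
-- universal polynomial type given by the family 𝒜, then s B is equal to
-- expand 𝒜 s B (instantiate-expand). Iterated η gives
--
--     s B ≃ λ⟨y_k⟩. s B ⟨y_k⟩ ≃ λ⟨y_k⟩. In_B{ El_B[ s B ⟨y_k⟩ ] }
--
-- (η-lam* and η-In: In_B{El_B[ ]} is exactly what repeated η-expansion of a
-- term of type B produces), and the body El_B[ s B ⟨y_k⟩ ] has the shape of the
-- left-hand side of a single ε-step with the context U = El_B, from the witness
-- C = B to the witness D = at(B). The right-hand side of that step is the body
-- of expand 𝒜 s B.
--
-- In the induction on the derivation, t B is first replaced by t↓ B, by
-- congruence. The expansion is then applied to s = t↓, so it has to be known
-- that t↓ is typable: this is the presupposition lemma ≃⇒⊢, which says that both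
-- sides of a derivable equation are typable. No closure of ≃ itself under
-- renaming is needed.
--
-- Two observations keep the syntax light. Contexts and types of derivable
-- judgements are in L²_RP (⊢⇒RPᶜ, ⊢⇒RP), where RP is stable under substitution
-- and a weakened formula can be un-weakened by substituting ∀X.X for the new
-- variable. And El_B contains no binder, so that composing the substitutions
-- that define it requires no commutation of substitution with weakening.

open import Data.Fin.Base using (Fin; zero; suc)
open import Data.List.Base using (List; []; _∷_; map)
open import Data.List.Properties using (map-∘; map-cong; map-id)
open import Data.List.Relation.Binary.Pointwise as Pointwise using (Pointwise; []; _∷_)
open import Data.List.Relation.Unary.All as All using (All; []; _∷_)
import Data.List.Relation.Unary.All.Properties as Allₚ
open import Data.Nat.Base using (ℕ; suc)
open import Data.Product.Base using (_×_; _,_; proj₁; proj₂)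
open import Data.Vec.Base as Vec using (_∷_; lookup)
open import Data.Vec.Functional using () renaming (_∷_ to _◂_)
open import Data.Vec.Properties using (lookup-map)
open import Data.Vec.Relation.Unary.All as VecAll using (_∷_)
import Data.Vec.Relation.Unary.All.Properties as VecAllₚ
open import Function.Base using (_∘_; id)
open import Relation.Binary.PropositionalEquality
  using (_≡_; refl; sym; trans; cong; cong₂; subst; subst₂)
open import Defs

private
  variable
    n n′ n″ m m′ m″ : ℕ

-- Renaming and substitution in formulas. Composites are described by a
-- pointwise hypothesis, so that no extensionality of functions is needed.

lift-∘ : {ρ : Fin n′ → Fin n″} {ρ′ : Fin n → Fin n′} {ρ″ : Fin n → Fin n″} →
         (∀ X → ρ (ρ′ X) ≡ ρ″ X) → ∀ X → lift ρ (lift ρ′ X) ≡ lift ρ″ X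
lift-∘ eq zero    = refl
lift-∘ eq (suc X) = cong suc (eq X)

lift-id : {ρ : Fin n → Fin n} → (∀ X → ρ X ≡ X) → ∀ X → lift ρ X ≡ X
lift-id eq zero    = refl
lift-id eq (suc X) = cong suc (eq X)

renᵗ-renᵗ : {ρ : Fin n′ → Fin n″} {ρ′ : Fin n → Fin n′} {ρ″ : Fin n → Fin n″} →
            (∀ X → ρ (ρ′ X) ≡ ρ″ X) →
            ∀ A → renᵗ ρ (renᵗ ρ′ A) ≡ renᵗ ρ″ A
renᵗ-renᵗ eq (tvar X) = cong tvar (eq X)
renᵗ-renᵗ eq (A ⊃ B)  = cong₂ _⊃_ (renᵗ-renᵗ eq A) (renᵗ-renᵗ eq B)
renᵗ-renᵗ eq (∀∙ A)   = cong ∀∙_ (renᵗ-renᵗ (lift-∘ eq) A)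

renᵗ-id : {ρ : Fin n → Fin n} → (∀ X → ρ X ≡ X) → ∀ A → renᵗ ρ A ≡ A
renᵗ-id eq (tvar X) = cong tvar (eq X)
renᵗ-id eq (A ⊃ B)  = cong₂ _⊃_ (renᵗ-id eq A) (renᵗ-id eq B)
renᵗ-id eq (∀∙ A)   = cong ∀∙_ (renᵗ-id (lift-id eq) A)

renᵗ-suc-comm : (ρ : Fin n → Fin n′) (A : Ty n) →
                renᵗ (lift ρ) (renᵗ suc A) ≡ renᵗ suc (renᵗ ρ A)
renᵗ-suc-comm ρ A =
  trans (renᵗ-renᵗ (λ _ → refl) A) (sym (renᵗ-renᵗ (λ _ → refl) A))

subᵗ-renᵗ : {σ : Fin n′ → Ty n″} {ρ : Fin n → Fin n′} {τ : Fin n → Ty n″} →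
            (∀ X → σ (ρ X) ≡ τ X) →
            ∀ A → subᵗ σ (renᵗ ρ A) ≡ subᵗ τ A
subᵗ-renᵗ eq (tvar X) = eq X
subᵗ-renᵗ eq (A ⊃ B)  = cong₂ _⊃_ (subᵗ-renᵗ eq A) (subᵗ-renᵗ eq B)
subᵗ-renᵗ eq (∀∙ A)   = cong ∀∙_
  (subᵗ-renᵗ (λ { zero → refl ; (suc X) → cong (renᵗ suc) (eq X) }) A)

renᵗ-subᵗ : {ρ : Fin n′ → Fin n″} {σ : Fin n → Ty n′} {τ : Fin n → Ty n″} →
            (∀ X → renᵗ ρ (σ X) ≡ τ X) →
            ∀ A → renᵗ ρ (subᵗ σ A) ≡ subᵗ τ A
renᵗ-subᵗ eq (tvar X) = eq X
renᵗ-subᵗ eq (A ⊃ B)  = cong₂ _⊃_ (renᵗ-subᵗ eq A) (renᵗ-subᵗ eq B)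
renᵗ-subᵗ {ρ = ρ} {σ} eq (∀∙ A) = cong ∀∙_
  (renᵗ-subᵗ (λ { zero → refl
                ; (suc X) → trans (renᵗ-suc-comm ρ (σ X)) (cong (renᵗ suc) (eq X)) })
             A)

subᵗ-tvar : {σ : Fin n → Ty n′} {ρ : Fin n → Fin n′} →
            (∀ X → σ X ≡ tvar (ρ X)) → ∀ A → subᵗ σ A ≡ renᵗ ρ A
subᵗ-tvar eq (tvar X) = eq X
subᵗ-tvar eq (A ⊃ B)  = cong₂ _⊃_ (subᵗ-tvar eq A) (subᵗ-tvar eq B)
subᵗ-tvar eq (∀∙ A)   = cong ∀∙_
  (subᵗ-tvar (λ { zero → refl ; (suc X) → cong (renᵗ suc) (eq X) }) A)

subᵗ-suc-comm : (σ : Fin n → Ty n′) (A : Ty n) →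
                subᵗ (tvar zero ◂ (renᵗ suc ∘ σ)) (renᵗ suc A) ≡ renᵗ suc (subᵗ σ A)
subᵗ-suc-comm σ A =
  trans (subᵗ-renᵗ (λ _ → refl) A) (sym (renᵗ-subᵗ (λ _ → refl) A))

renᵗ-suc-⟦⟧ : (A B : Ty n) → renᵗ suc A ⟦ B ⟧ ≡ A
renᵗ-suc-⟦⟧ A B =
  trans (subᵗ-renᵗ (λ _ → refl) A)
        (trans (subᵗ-tvar (λ _ → refl) A) (renᵗ-id (λ _ → refl) A))

renᵗ-⟦⟧ : (ρ : Fin n → Fin n′) (A : Ty (suc n)) (B : Ty n) →
          renᵗ (lift ρ) A ⟦ renᵗ ρ B ⟧ ≡ renᵗ ρ (A ⟦ B ⟧)
renᵗ-⟦⟧ ρ A B =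
  trans (subᵗ-renᵗ (λ _ → refl) A)
        (sym (renᵗ-subᵗ (λ { zero → refl ; (suc X) → refl }) A))

renᵗ-lift-⟦tvar⟧ : (ρ : Fin (suc n) → Fin n′) (A : Ty (suc n)) →
                   renᵗ (lift (ρ ∘ suc)) A ⟦ tvar (ρ zero) ⟧ ≡ renᵗ ρ A
renᵗ-lift-⟦tvar⟧ ρ A =
  trans (subᵗ-renᵗ (λ _ → refl) A)
        (subᵗ-tvar (λ { zero → refl ; (suc X) → refl }) A)

-- Universal polynomial formulas under renaming and substitution

module _ (h : Ty n → Ty n′) (h-⊃ : ∀ A B → h (A ⊃ B) ≡ h A ⊃ h B) where

  hom-⊃* : ∀ As B → h (As ⊃* B) ≡ map h As ⊃* h B
  hom-⊃* []       B = refl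
  hom-⊃* (A ∷ As) B = trans (h-⊃ A (As ⊃* B)) (cong (h A ⊃_) (hom-⊃* As B))

  hom-matrix : ∀ 𝒜 C → h (matrix 𝒜 C) ≡ matrix (map (map h) 𝒜) (h C)
  hom-matrix []       C = refl
  hom-matrix (As ∷ 𝒜) C =
    trans (h-⊃ (As ⊃* C) (matrix 𝒜 C))
          (cong₂ _⊃_ (hom-⊃* As C) (hom-matrix 𝒜 C))

module _ {a} {A B B′ C : Set a} {f : B → C} {g : A → B} {f′ : B′ → C} {g′ : A → B′} where

  map-map-comm : (∀ x → f (g x) ≡ f′ (g′ x)) → ∀ xss →
                 map (map f) (map (map g) xss) ≡ map (map f′) (map (map g′) xss)
  map-map-comm eq xss =
    trans (sym (map-∘ xss))
          (trans (map-cong (λ xs → trans (sym (map-∘ xs))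
                                         (trans (map-cong eq xs) (map-∘ xs))) xss)
                 (map-∘ xss))

renᵗ-univPoly : (ρ : Fin n → Fin n′) (𝒜 : Family n) →
                renᵗ ρ (univPoly 𝒜) ≡ univPoly (renᶠ ρ 𝒜)
renᵗ-univPoly ρ 𝒜 = cong ∀∙_
  (trans (hom-matrix (renᵗ (lift ρ)) (λ _ _ → refl) (renᶠ suc 𝒜) (tvar zero))
         (cong (λ ℬ → matrix ℬ (tvar zero)) (map-map-comm (renᵗ-suc-comm ρ) 𝒜)))

subᵗ-univPoly : (σ : Fin n → Ty n′) (𝒜 : Family n) →
                subᵗ σ (univPoly 𝒜) ≡ univPoly (map (map (subᵗ σ)) 𝒜)
subᵗ-univPoly σ 𝒜 = cong ∀∙_
  (trans (hom-matrix (subᵗ (tvar zero ◂ (renᵗ suc ∘ σ))) (λ _ _ → refl)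
                     (renᶠ suc 𝒜) (tvar zero))
         (cong (λ ℬ → matrix ℬ (tvar zero)) (map-map-comm (subᵗ-suc-comm σ) 𝒜)))

matrix-⟦⟧ : (𝒜 : Family n) (B : Ty n) →
            matrix (renᶠ suc 𝒜) (tvar zero) ⟦ B ⟧ ≡ matrix 𝒜 B
matrix-⟦⟧ 𝒜 B =
  trans (hom-matrix (_⟦ B ⟧) (λ _ _ → refl) (renᶠ suc 𝒜) (tvar zero))
        (cong (λ ℬ → matrix ℬ B) (instance-of-weakening 𝒜))
  where
  instance-of-weakening : ∀ 𝒜 → map (map (_⟦ B ⟧)) (renᶠ suc 𝒜) ≡ 𝒜
  instance-of-weakening 𝒜 =
    trans (sym (map-∘ 𝒜))
          (trans (map-cong (λ As → trans (sym (map-∘ As))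
                                         (trans (map-cong (λ A → renᵗ-suc-⟦⟧ A B) As)
                                                (map-id As))) 𝒜)
                 (map-id 𝒜))

-- Closure properties of L²_RP

mutual

  RP-subᵗ : {σ : Fin n → Ty n′} → (∀ X → RP (σ X)) → ∀ {A} → RP A → RP (subᵗ σ A)
  RP-subᵗ rσ (tvar X) = rσ X
  RP-subᵗ rσ (r ⊃ s)  = RP-subᵗ rσ r ⊃ RP-subᵗ rσ s
  RP-subᵗ {σ = σ} rσ (univ {𝒜} rs) =
    subst RP (sym (subᵗ-univPoly σ 𝒜)) (univ (RP-subᶠ rσ rs))

  RP-subᶠ : {σ : Fin n → Ty n′} → (∀ X → RP (σ X)) →
            ∀ {𝒜} → All (All RP) 𝒜 → All (All RP) (map (map (subᵗ σ)) 𝒜)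
  RP-subᶠ rσ []         = []
  RP-subᶠ rσ (rs ∷ rss) = RP-sub* rσ rs ∷ RP-subᶠ rσ rss

  RP-sub* : {σ : Fin n → Ty n′} → (∀ X → RP (σ X)) →
            ∀ {As} → All RP As → All RP (map (subᵗ σ) As)
  RP-sub* rσ []       = []
  RP-sub* rσ (r ∷ rs) = RP-subᵗ rσ r ∷ RP-sub* rσ rs

RP-renᵗ : (ρ : Fin n → Fin n′) → ∀ {A} → RP A → RP (renᵗ ρ A)
RP-renᵗ ρ {A} r =
  subst RP (subᵗ-tvar (λ _ → refl) A) (RP-subᵗ (λ X → tvar (ρ X)) r)

RP-⟦⟧ : {A : Ty (suc n)} {B : Ty n} → RP A → RP B → RP (A ⟦ B ⟧)
RP-⟦⟧ rA rB = RP-subᵗ (λ { zero → rB ; (suc X) → tvar X }) rA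

-- The new variable is instantiated by ∀X.X, the universal polynomial formula
-- of the empty family, which exists even when there is no variable.
RP-renᵗ-suc⁻ : {A : Ty n} → RP (renᵗ suc A) → RP A
RP-renᵗ-suc⁻ {A = A} r =
  subst RP (renᵗ-suc-⟦⟧ A (univPoly [])) (RP-⟦⟧ r (univ []))

RP-⊃* : {As : List (Ty n)} {B : Ty n} → All RP As → RP B → RP (As ⊃* B)
RP-⊃* []       s = s
RP-⊃* (r ∷ rs) s = r ⊃ RP-⊃* rs s

RP-⊃*⁻ : {As : List (Ty n)} {B : Ty n} → RP (As ⊃* B) → All RP As
RP-⊃*⁻ {As = []}    r       = []
RP-⊃*⁻ {As = _ ∷ _} (r ⊃ s) = r ∷ RP-⊃*⁻ s

RP-⊃*s : {𝒜 : Family n} {C : Ty n} → All (All RP) 𝒜 → RP C → All RP (map (_⊃* C) 𝒜)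
RP-⊃*s rss s = Allₚ.map⁺ (All.map (λ rs → RP-⊃* rs s) rss)

RP-∀ : {A : Ty (suc n)} → RP (∀∙ A) → RP A
RP-∀ (univ rss) =
  RP-⊃* (RP-⊃*s (Allₚ.gmap⁺ (Allₚ.gmap⁺ (RP-renᵗ suc)) rss) (tvar zero)) (tvar zero)

RP-univPoly⁻ : {𝒜 : Family n} → RP (univPoly 𝒜) → All (All RP) 𝒜
RP-univPoly⁻ {𝒜 = 𝒜} r =
  Allₚ.gmap⁻ (Allₚ.gmap⁻ RP-renᵗ-suc⁻)
    (All.map (λ {As} → RP-⊃*⁻ {As = As})
      (Allₚ.map⁻ (RP-⊃*⁻ {As = map (_⊃* tvar zero) (renᶠ suc 𝒜)} (RP-∀ r))))

-- Γ ⊢ t : A implies that Γ and A are in L²_RP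

RPᶜ : Ctx n m → Set
RPᶜ = VecAll.All RP

RPᶜ-suc : {Γ : Ctx n m} → RPᶜ Γ → RPᶜ (Vec.map (renᵗ suc) Γ)
RPᶜ-suc = VecAllₚ.gmap (RP-renᵗ suc)

⊢⇒RPᶜ : {Γ : Ctx n m} {t : Tm n m} {A : Ty n} → Γ ⊢ t ∶ A → RPᶜ Γ
⊢⇒RPᶜ (⊢var rΓ x)   = rΓ
⊢⇒RPᶜ (⊢lam _ d)    = VecAll.tail (⊢⇒RPᶜ d)
⊢⇒RPᶜ (⊢app d e)    = ⊢⇒RPᶜ d
⊢⇒RPᶜ (⊢Lam _ d)    = VecAll.map RP-renᵗ-suc⁻ (VecAllₚ.map⁻ (⊢⇒RPᶜ d))
⊢⇒RPᶜ (⊢tapp _ _ d) = ⊢⇒RPᶜ d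

⊢⇒RP : {Γ : Ctx n m} {t : Tm n m} {A : Ty n} → Γ ⊢ t ∶ A → RP A
⊢⇒RP (⊢var rΓ x)     = VecAllₚ.lookup⁺ rΓ x
⊢⇒RP (⊢lam r d)      = r ⊃ ⊢⇒RP d
⊢⇒RP (⊢app d e) with ⊢⇒RP d
... | _ ⊃ s          = s
⊢⇒RP (⊢Lam r d)      = r
⊢⇒RP (⊢tapp r rB d)  = RP-⟦⟧ (RP-∀ r) rB

-- Renaming of terms

ren-ren : {ρ : Fin m′ → Fin m″} {ρ′ : Fin m → Fin m′} {ρ″ : Fin m → Fin m″} →
          (∀ x → ρ (ρ′ x) ≡ ρ″ x) →
          (t : Tm n m) → ren ρ (ren ρ′ t) ≡ ren ρ″ t
ren-ren eq (var x)    = cong var (eq x)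
ren-ren eq (lam A t)  = cong (lam A) (ren-ren (lift-∘ eq) t)
ren-ren eq (app t u)  = cong₂ app (ren-ren eq t) (ren-ren eq u)
ren-ren eq (Lam t)    = cong Lam (ren-ren eq t)
ren-ren eq (tapp t B) = cong (λ s → tapp s B) (ren-ren eq t)

ren-id : {ρ : Fin m → Fin m} → (∀ x → ρ x ≡ x) → (t : Tm n m) → ren ρ t ≡ t
ren-id eq (var x)    = cong var (eq x)
ren-id eq (lam A t)  = cong (lam A) (ren-id (lift-id eq) t)
ren-id eq (app t u)  = cong₂ app (ren-id eq t) (ren-id eq u)
ren-id eq (Lam t)    = cong Lam (ren-id eq t)
ren-id eq (tapp t B) = cong (λ s → tapp s B) (ren-id eq t)

tren-tren : {θ : Fin n′ → Fin n″} {θ′ : Fin n → Fin n′} {θ″ : Fin n → Fin n″} →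
            (∀ X → θ (θ′ X) ≡ θ″ X) →
            (t : Tm n m) → tren θ (tren θ′ t) ≡ tren θ″ t
tren-tren eq (var x)    = refl
tren-tren eq (lam A t)  = cong₂ lam (renᵗ-renᵗ eq A) (tren-tren eq t)
tren-tren eq (app t u)  = cong₂ app (tren-tren eq t) (tren-tren eq u)
tren-tren eq (Lam t)    = cong Lam (tren-tren (lift-∘ eq) t)
tren-tren eq (tapp t B) = cong₂ tapp (tren-tren eq t) (renᵗ-renᵗ eq B)

tren-id : {θ : Fin n → Fin n} → (∀ X → θ X ≡ X) → (t : Tm n m) → tren θ t ≡ t
tren-id eq (var x)    = refl
tren-id eq (lam A t)  = cong₂ lam (renᵗ-id eq A) (tren-id eq t)
tren-id eq (app t u)  = cong₂ app (tren-id eq t) (tren-id eq u)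
tren-id eq (Lam t)    = cong Lam (tren-id (lift-id eq) t)
tren-id eq (tapp t B) = cong₂ tapp (tren-id eq t) (renᵗ-id eq B)

tren-ren : (θ : Fin n → Fin n′) (ρ : Fin m → Fin m′) (t : Tm n m) →
           tren θ (ren ρ t) ≡ ren ρ (tren θ t)
tren-ren θ ρ (var x)    = refl
tren-ren θ ρ (lam A t)  = cong (lam (renᵗ θ A)) (tren-ren θ (lift ρ) t)
tren-ren θ ρ (app t u)  = cong₂ app (tren-ren θ ρ t) (tren-ren θ ρ u)
tren-ren θ ρ (Lam t)    = cong Lam (tren-ren (lift θ) ρ t)
tren-ren θ ρ (tapp t B) = cong (λ s → tapp s (renᵗ θ B)) (tren-ren θ ρ t)

-- Weakening and substitution preserve typing

⊢var≡ : {Γ : Ctx n m} {x : Fin m} {A : Ty n} →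
        RPᶜ Γ → lookup Γ x ≡ A → Γ ⊢ var x ∶ A
⊢var≡ rΓ refl = ⊢var rΓ _

⊢cast : {Γ : Ctx n m} {t : Tm n m} {A B : Ty n} → A ≡ B → Γ ⊢ t ∶ A → Γ ⊢ t ∶ B
⊢cast refl d = d

-- Simultaneous renaming of the type variables by θ and of the term variables
-- by ρ. Treating both at once leaves a single induction.
⊢ren-tren : {Γ : Ctx n m} {Δ : Ctx n′ m′} {θ : Fin n → Fin n′} {ρ : Fin m → Fin m′} →
            RPᶜ Δ → (∀ x → lookup Δ (ρ x) ≡ renᵗ θ (lookup Γ x)) →
            ∀ {t A} → Γ ⊢ t ∶ A → Δ ⊢ ren ρ (tren θ t) ∶ renᵗ θ A
⊢ren-tren rΔ eq (⊢var _ x) = ⊢var≡ rΔ (eq x)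
⊢ren-tren {θ = θ} rΔ eq (⊢lam r d) =
  ⊢lam r′ (⊢ren-tren (r′ ∷ rΔ) (λ { zero → refl ; (suc x) → eq x }) d)
  where r′ = RP-renᵗ θ r
⊢ren-tren rΔ eq (⊢app d e) = ⊢app (⊢ren-tren rΔ eq d) (⊢ren-tren rΔ eq e)
⊢ren-tren {Γ = Γ} {Δ} {θ} {ρ} rΔ eq (⊢Lam r d) =
  ⊢Lam (RP-renᵗ θ r) (⊢ren-tren (RPᶜ-suc rΔ) eq′ d)
  where
  eq′ : ∀ x → lookup (Vec.map (renᵗ suc) Δ) (ρ x) ≡
              renᵗ (lift θ) (lookup (Vec.map (renᵗ suc) Γ) x)
  eq′ x = trans (lookup-map (ρ x) (renᵗ suc) Δ)
         (trans (cong (renᵗ suc) (eq x))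
         (trans (sym (renᵗ-suc-comm θ (lookup Γ x)))
                (cong (renᵗ (lift θ)) (sym (lookup-map x (renᵗ suc) Γ)))))
⊢ren-tren {θ = θ} rΔ eq (⊢tapp {A = A} {B} r rB d) =
  ⊢cast (renᵗ-⟦⟧ θ A B)
    (⊢tapp (RP-renᵗ θ r) (RP-renᵗ θ rB) (⊢ren-tren rΔ eq d))

⊢ren : {Γ : Ctx n m} {Δ : Ctx n m′} {ρ : Fin m → Fin m′} →
       RPᶜ Δ → (∀ x → lookup Δ (ρ x) ≡ lookup Γ x) →
       ∀ {t A} → Γ ⊢ t ∶ A → Δ ⊢ ren ρ t ∶ A
⊢ren {Δ = Δ} {ρ} rΔ eq {t} {A} d =
  subst₂ (Δ ⊢_∶_) (cong (ren ρ) (tren-id (λ _ → refl) t)) (renᵗ-id (λ _ → refl) A)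
    (⊢ren-tren rΔ (λ x → trans (eq x) (sym (renᵗ-id (λ _ → refl) _))) d)

⊢tren-suc : {Γ : Ctx n m} {t : Tm n m} {A : Ty n} →
            Γ ⊢ t ∶ A → Vec.map (renᵗ suc) Γ ⊢ tren suc t ∶ renᵗ suc A
⊢tren-suc {Γ = Γ} d =
  subst (_ ⊢_∶ _) (ren-id (λ _ → refl) _)
    (⊢ren-tren (RPᶜ-suc (⊢⇒RPᶜ d)) (λ x → lookup-map x (renᵗ suc) Γ) d)

⊢ren-suc : {Γ : Ctx n m} {t : Tm n m} {A B : Ty n} →
           RP B → Γ ⊢ t ∶ A → B ∷ Γ ⊢ ren suc t ∶ A
⊢ren-suc r d = ⊢ren (r ∷ ⊢⇒RPᶜ d) (λ _ → refl) d

⊢sub : {Γ : Ctx n m} {Δ : Ctx n m′} {σ : Fin m → Tm n m′} →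
       RPᶜ Δ → (∀ x → Δ ⊢ σ x ∶ lookup Γ x) →
       ∀ {t A} → Γ ⊢ t ∶ A → Δ ⊢ sub σ t ∶ A
⊢sub rΔ dσ (⊢var _ x)  = dσ x
⊢sub rΔ dσ (⊢lam r d)  =
  ⊢lam r (⊢sub (r ∷ rΔ) (λ { zero → ⊢var (r ∷ rΔ) zero ; (suc x) → ⊢ren-suc r (dσ x) }) d)
⊢sub rΔ dσ (⊢app d e)  = ⊢app (⊢sub rΔ dσ d) (⊢sub rΔ dσ e)
⊢sub {Γ = Γ} rΔ dσ (⊢Lam r d) =
  ⊢Lam r (⊢sub (RPᶜ-suc rΔ)
               (λ x → ⊢cast (sym (lookup-map x (renᵗ suc) Γ)) (⊢tren-suc (dσ x))) d)
⊢sub rΔ dσ (⊢tapp r rB d) = ⊢tapp r rB (⊢sub rΔ dσ d)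

⊢plug : {Γ : Ctx n m} {Δ : Ctx n m′} {ρ : Fin m → Fin m′} {U : TmCtx n m} {C D : Ty n} →
        (∀ x → lookup Δ (ρ x) ≡ lookup Γ x) → C ∷ Γ ⊢ U ∶ D →
        ∀ {t} → Δ ⊢ t ∶ C → Δ ⊢ plug U ρ t ∶ D
⊢plug eq dU d =
  ⊢sub rΔ (λ { zero → d ; (suc x) → ⊢var≡ rΔ (eq x) }) dU
  where rΔ = ⊢⇒RPᶜ d

-- Iterated abstraction and application

-- Γ extended by variables of types As, the last one innermost: a context over
-- the scope m ⊞ As.
_⊞ᶜ_ : Ctx n m → (As : List (Ty n)) → Ctx n (m ⊞ As)
Γ ⊞ᶜ []       = Γ
Γ ⊞ᶜ (A ∷ As) = (A ∷ Γ) ⊞ᶜ As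

RPᶜ-⊞ : {Γ : Ctx n m} {As : List (Ty n)} → RPᶜ Γ → All RP As → RPᶜ (Γ ⊞ᶜ As)
RPᶜ-⊞ rΓ []       = rΓ
RPᶜ-⊞ rΓ (r ∷ rs) = RPᶜ-⊞ (r ∷ rΓ) rs

lookup-weaken : {Γ : Ctx n m} (As : List (Ty n)) (x : Fin m) →
                lookup (Γ ⊞ᶜ As) (weaken As x) ≡ lookup Γ x
lookup-weaken []       x = refl
lookup-weaken (A ∷ As) x = lookup-weaken As (suc x)

lookup-fresh : {Γ : Ctx n m} (As : List (Ty n)) →
               Pointwise (λ A x → lookup (Γ ⊞ᶜ As) x ≡ A) As (fresh As)
lookup-fresh []       = []
lookup-fresh (A ∷ As) = lookup-weaken As zero ∷ lookup-fresh As

⊢ren-weaken : {Γ : Ctx n m} {As : List (Ty n)} → All RP As →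
              ∀ {t A} → Γ ⊢ t ∶ A → Γ ⊞ᶜ As ⊢ ren (weaken As) t ∶ A
⊢ren-weaken {As = As} rs d = ⊢ren (RPᶜ-⊞ (⊢⇒RPᶜ d) rs) (lookup-weaken As) d

⊢lam* : {Γ : Ctx n m} {As : List (Ty n)} → All RP As →
        ∀ {t B} → Γ ⊞ᶜ As ⊢ t ∶ B → Γ ⊢ lam* As t ∶ As ⊃* B
⊢lam* []       d = d
⊢lam* (r ∷ rs) d = ⊢lam r (⊢lam* rs d)

⊢app*-var : {Γ : Ctx n m} {As : List (Ty n)} {B : Ty n} {xs : List (Fin m)} →
            Pointwise (λ A x → lookup Γ x ≡ A) As xs →
            ∀ {t} → Γ ⊢ t ∶ As ⊃* B → Γ ⊢ app* t (map var xs) ∶ B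
⊢app*-var []         d = d
⊢app*-var (eq ∷ eqs) d = ⊢app*-var eqs (⊢app d (⊢var≡ (⊢⇒RPᶜ d) eq))

⊢app*-fresh : {Γ : Ctx n m} {As : List (Ty n)} {B : Ty n} → All RP As →
              ∀ {t} → Γ ⊢ t ∶ As ⊃* B →
              Γ ⊞ᶜ As ⊢ app* (ren (weaken As) t) (map var (fresh As)) ∶ B
⊢app*-fresh {As = As} rs d = ⊢app*-var (lookup-fresh As) (⊢ren-weaken rs d)

⊢app*-matrix : {Γ : Ctx n m} {𝒜 : Family n} {C : Ty n} {us : List (Tm n m)} →
               Pointwise (λ As u → Γ ⊢ u ∶ As ⊃* C) 𝒜 us →
               ∀ {t} → Γ ⊢ t ∶ matrix 𝒜 C → Γ ⊢ app* t us ∶ C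
⊢app*-matrix []       d = d
⊢app*-matrix (e ∷ es) d = ⊢app*-matrix es (⊢app d e)

⊢inside : {Γ : Ctx n m} {𝒜 : Family n} {C D : Ty n} {us : List (Tm n m)} {U : TmCtx n m} →
          All (All RP) 𝒜 → Pointwise (λ As u → Γ ⊢ u ∶ As ⊃* C) 𝒜 us → C ∷ Γ ⊢ U ∶ D →
          Pointwise (λ As u → Γ ⊢ u ∶ As ⊃* D) 𝒜 (inside U 𝒜 us)
⊢inside []         []       dU = []
⊢inside {𝒜 = As ∷ _} (rs ∷ rss) (e ∷ es) dU =
  ⊢lam* rs (⊢plug (lookup-weaken As) dU (⊢app*-fresh rs e)) ∷ ⊢inside rss es dU

⊢tapp-univPoly : {Γ : Ctx n m} (𝒜 : Family n) {t : Tm n m} {B : Ty n} →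
                 RP B → Γ ⊢ t ∶ univPoly 𝒜 → Γ ⊢ tapp t B ∶ matrix 𝒜 B
⊢tapp-univPoly 𝒜 {B = B} r d = ⊢cast (matrix-⟦⟧ 𝒜 B) (⊢tapp (⊢⇒RP d) r d)

⊢tapp-tren-suc : {Γ : Ctx n m} {t : Tm n m} {A : Ty (suc n)} → Γ ⊢ t ∶ ∀∙ A →
                Vec.map (renᵗ suc) Γ ⊢ tapp (tren suc t) (tvar zero) ∶ A
⊢tapp-tren-suc {A = A} d =
  ⊢cast (trans (renᵗ-lift-⟦tvar⟧ id A) (renᵗ-id (λ _ → refl) A))
    (⊢tapp (RP-renᵗ suc (⊢⇒RP d)) (tvar zero) (⊢tren-suc d))

≃-cast : {Γ : Ctx n m} {t s : Tm n m} {A B : Ty n} →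
         A ≡ B → Γ ⊢ t ≃ s ∶ A → Γ ⊢ t ≃ s ∶ B
≃-cast refl p = p

≃-castˡ : {Γ : Ctx n m} {t t′ s : Tm n m} {A : Ty n} →
          t ≡ t′ → Γ ⊢ t ≃ s ∶ A → Γ ⊢ t′ ≃ s ∶ A
≃-castˡ refl p = p

-- Presupposition: both sides of a derivable equation are typable

≃⇒⊢ : {Γ : Ctx n m} {t s : Tm n m} {A : Ty n} →
      Γ ⊢ t ≃ s ∶ A → Γ ⊢ t ∶ A × Γ ⊢ s ∶ A
≃⇒⊢ (≃-refl d)      = d , d
≃⇒⊢ (≃-sym p)       = proj₂ (≃⇒⊢ p) , proj₁ (≃⇒⊢ p)
≃⇒⊢ (≃-trans p q)   = proj₁ (≃⇒⊢ p) , proj₂ (≃⇒⊢ q)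
≃⇒⊢ (≃-lam r p)     with d , e ← ≃⇒⊢ p = ⊢lam r d , ⊢lam r e
≃⇒⊢ (≃-app p q)     with d , e ← ≃⇒⊢ p | d′ , e′ ← ≃⇒⊢ q = ⊢app d d′ , ⊢app e e′
≃⇒⊢ (≃-Lam r p)     with d , e ← ≃⇒⊢ p = ⊢Lam r d , ⊢Lam r e
≃⇒⊢ (≃-tapp r rB p) with d , e ← ≃⇒⊢ p = ⊢tapp r rB d , ⊢tapp r rB e
≃⇒⊢ (⊃η d) with ⊢⇒RP d
... | r ⊃ _ = d , ⊢lam r (⊢app (⊢ren-suc r d) (⊢var (r ∷ ⊢⇒RPᶜ d) zero))
≃⇒⊢ (∀η d) = d , ⊢Lam (⊢⇒RP d) (⊢tapp-tren-suc d)
≃⇒⊢ (ε {𝒜} rC rD d ds dU) =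
  ⊢plug (λ _ → refl) dU (⊢app*-matrix ds (⊢tapp-univPoly 𝒜 rC d)) ,
  ⊢app*-matrix (⊢inside (RP-univPoly⁻ {𝒜 = 𝒜} (⊢⇒RP d)) ds dU) (⊢tapp-univPoly 𝒜 rD d)

-- The weak expansion contexts

-- The context reached from Γ inside In_B.
scopeᶜ : (B : Ty n) → Ctx n m → Ctx (tscope B) (scope B m)
scopeᶜ (tvar Z) Γ = Γ
scopeᶜ (C ⊃ D)  Γ = scopeᶜ D (C ∷ Γ)
scopeᶜ (∀∙ D)   Γ = scopeᶜ D (Vec.map (renᵗ suc) Γ)

-- A term weakened past the fresh variables of In_B.
into : (B : Ty n) → Tm n m → Tm (tscope B) (scope B m)
into B t = ren (into-scope B) (tren (into-tscope B) t)

RPᶜ-scope : {B : Ty n} {Γ : Ctx n m} → RP B → RPᶜ Γ → RPᶜ (scopeᶜ B Γ)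
RPᶜ-scope {B = tvar Z} r       rΓ = rΓ
RPᶜ-scope {B = C ⊃ D}  (r ⊃ s) rΓ = RPᶜ-scope s (r ∷ rΓ)
RPᶜ-scope {B = ∀∙ D}   r       rΓ = RPᶜ-scope (RP-∀ r) (RPᶜ-suc rΓ)

lookup-into : (B : Ty n) {Γ : Ctx n m} (x : Fin m) →
              lookup (scopeᶜ B Γ) (into-scope B x) ≡ renᵗ (into-tscope B) (lookup Γ x)
lookup-into (tvar Z) x = sym (renᵗ-id (λ _ → refl) _)
lookup-into (C ⊃ D)  x = lookup-into D (suc x)
lookup-into (∀∙ D) {Γ} x =
  trans (lookup-into D x)
        (trans (cong (renᵗ (into-tscope D)) (lookup-map x (renᵗ suc) Γ))
               (renᵗ-renᵗ (λ _ → refl) (lookup Γ x)))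

⊢into : (B : Ty n) {Γ : Ctx n m} {t : Tm n m} {A : Ty n} → RP B →
        Γ ⊢ t ∶ A → scopeᶜ B Γ ⊢ into B t ∶ renᵗ (into-tscope B) A
⊢into B r d = ⊢ren-tren (RPᶜ-scope r (⊢⇒RPᶜ d)) (lookup-into B) d

⊢El : (B : Ty n) {Γ : Ctx n m} → RP B → RPᶜ Γ →
      renᵗ (into-tscope B) B ∷ scopeᶜ B Γ ⊢ El B ∶ tvar (at B)
⊢El (tvar Z) r rΓ = ⊢var (r ∷ rΓ) zero
⊢El (C ⊃ D) {Γ} r@(rC ⊃ rD) rΓ =
  ⊢plug (λ _ → refl) (⊢El D rD (rC ∷ rΓ))
    (⊢app (⊢var rΔ zero) (⊢var≡ rΔ (lookup-into D zero)))
  where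
  rΔ : RPᶜ (renᵗ (into-tscope D) (C ⊃ D) ∷ scopeᶜ D (C ∷ Γ))
  rΔ = RP-renᵗ (into-tscope D) r ∷ RPᶜ-scope rD (rC ∷ rΓ)
⊢El (∀∙ D) {Γ} r rΓ =
  ⊢plug (λ _ → refl) (⊢El D (RP-∀ r) (RPᶜ-suc rΓ))
    (⊢cast (renᵗ-lift-⟦tvar⟧ (into-tscope D) D)
      (⊢tapp r′ (tvar _) (⊢var (r′ ∷ RPᶜ-scope r rΓ) zero)))
  where
  r′ = RP-renᵗ (into-tscope (∀∙ D)) r

-- Terms in which no variable is bound. On them, substitutions compose without
-- ever going under a binder; El_B is such a term.
data BinderFree {n m : ℕ} : Tm n m → Set where
  var  : ∀ x → BinderFree (var x)
  app  : ∀ {t u} → BinderFree t → BinderFree u → BinderFree (app t u)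
  tapp : ∀ {t} → BinderFree t → ∀ B → BinderFree (tapp t B)

BinderFree-sub : {σ : Fin m → Tm n m′} → (∀ x → BinderFree (σ x)) →
                 ∀ {t} → BinderFree t → BinderFree (sub σ t)
BinderFree-sub bσ (var x)    = bσ x
BinderFree-sub bσ (app b c)  = app (BinderFree-sub bσ b) (BinderFree-sub bσ c)
BinderFree-sub bσ (tapp b B) = tapp (BinderFree-sub bσ b) B

sub-sub : {τ : Fin m′ → Tm n m″} {σ : Fin m → Tm n m′} {υ : Fin m → Tm n m″} →
          (∀ x → sub τ (σ x) ≡ υ x) →
          ∀ {t} → BinderFree t → sub τ (sub σ t) ≡ sub υ t
sub-sub eq (var x)    = eq x
sub-sub eq (app b c)  = cong₂ app (sub-sub eq b) (sub-sub eq c)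
sub-sub eq (tapp b B) = cong (λ s → tapp s B) (sub-sub eq b)

BinderFree-El : (B : Ty n) → BinderFree (El {m = m} B)
BinderFree-El (tvar Z) = var zero
BinderFree-El (C ⊃ D)  =
  BinderFree-sub (λ { zero → app (var zero) (var _) ; (suc x) → var _ }) (BinderFree-El D)
BinderFree-El (∀∙ D)   =
  BinderFree-sub (λ { zero → tapp (var zero) _ ; (suc x) → var _ }) (BinderFree-El D)

-- The defining equations of El, read at a term t in the hole.
El-⊃-[] : (C D : Ty n) (t : Tm _ (scope (C ⊃ D) m)) →
          El (C ⊃ D) [ t ] ≡ El D [ app t (var (into-scope D zero)) ]
El-⊃-[] C D t = sub-sub (λ { zero → refl ; (suc x) → refl }) (BinderFree-El D)

El-∀-[] : (D : Ty (suc n)) (t : Tm _ (scope (∀∙ D) m)) →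
          El (∀∙ D) [ t ] ≡ El D [ tapp t (tvar (into-tscope D zero)) ]
El-∀-[] D t = sub-sub (λ { zero → refl ; (suc x) → refl }) (BinderFree-El D)

-- Iterated η-expansion, combined with congruence in the body

η-lam* : {Γ : Ctx n m} {As : List (Ty n)} {B : Ty n} {s : Tm n m} {r : Tm n (m ⊞ As)} →
         All RP As → Γ ⊢ s ∶ As ⊃* B →
         Γ ⊞ᶜ As ⊢ app* (ren (weaken As) s) (map var (fresh As)) ≃ r ∶ B →
         Γ ⊢ s ≃ lam* As r ∶ As ⊃* B
η-lam* {s = s} [] d p =
  ≃-castˡ (ren-id (λ _ → refl) s) p
η-lam* {Γ = Γ} {As = A ∷ As} {B} {s} {r} (rA ∷ rs) d p =
  ≃-trans (⊃η d) (≃-lam rA (η-lam* rs d′ p′))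
  where
  d′ : A ∷ Γ ⊢ app (ren suc s) (var zero) ∶ As ⊃* B
  d′ = ⊢app (⊢ren-suc rA d) (⊢var (rA ∷ ⊢⇒RPᶜ d) zero)

  p′ : (A ∷ Γ) ⊞ᶜ As ⊢
         app* (ren (weaken As) (app (ren suc s) (var zero))) (map var (fresh As)) ≃ r ∶ B
  p′ = subst (λ s′ → (A ∷ Γ) ⊞ᶜ As ⊢
                app* (app s′ (var (weaken As zero))) (map var (fresh As)) ≃ r ∶ B)
         (sym (ren-ren (λ _ → refl) s)) p

into-ren : (B : Ty n) {ρ : Fin m → Fin m′} (s : Tm n m) →
           into B (ren ρ s) ≡ ren (into-scope B ∘ ρ) (tren (into-tscope B) s)
into-ren B s =
  trans (cong (ren (into-scope B)) (tren-ren _ _ s)) (ren-ren (λ _ → refl) _)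

into-tren : (B : Ty n′) {θ : Fin n → Fin n′} (s : Tm n m) →
            into B (tren θ s) ≡ ren (into-scope B) (tren (into-tscope B ∘ θ) s)
into-tren B s = cong (ren (into-scope B)) (tren-tren (λ _ → refl) s)

η-In : (B : Ty n) {Γ : Ctx n m} {s : Tm n m} {r : Tm (tscope B) (scope B m)} →
       RP B → Γ ⊢ s ∶ B →
       scopeᶜ B Γ ⊢ El B [ into B s ] ≃ r ∶ tvar (at B) →
       Γ ⊢ s ≃ In B r ∶ B
η-In (tvar Z) {s = s} _ d p =
  ≃-castˡ
    (trans (ren-id (λ _ → refl) _) (tren-id (λ _ → refl) s)) p
η-In (C ⊃ D) {Γ} {s} (rC ⊃ rD) d p =
  ≃-trans (⊃η d) (≃-lam rC (η-In D rD d′ (≃-castˡ eq p)))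
  where
  d′ : C ∷ Γ ⊢ app (ren suc s) (var zero) ∶ D
  d′ = ⊢app (⊢ren-suc rC d) (⊢var (rC ∷ ⊢⇒RPᶜ d) zero)

  eq : El (C ⊃ D) [ into (C ⊃ D) s ] ≡ El D [ into D (app (ren suc s) (var zero)) ]
  eq = trans (El-⊃-[] C D _)
             (cong (λ s′ → El D [ app s′ (var (into-scope D zero)) ]) (sym (into-ren D s)))
η-In (∀∙ D) {Γ} {s} r d p =
  ≃-trans (∀η d) (≃-Lam r (η-In D (RP-∀ r) (⊢tapp-tren-suc d) (≃-castˡ eq p)))
  where
  eq : El (∀∙ D) [ into (∀∙ D) s ] ≡ El D [ into D (tapp (tren suc s) (tvar zero)) ]
  eq = trans (El-∀-[] D _)
             (cong (λ s′ → El D [ tapp s′ (tvar (into-tscope D zero)) ]) (sym (into-tren D s)))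

-- Expansion of a single instance

into-app* : (B : Ty n) (t : Tm n m) (xs : List (Fin m)) →
            into B (app* t (map var xs)) ≡ app* (into B t) (map (var ∘ into-scope B) xs)
into-app* B t []       = refl
into-app* B t (x ∷ xs) = into-app* B (app t (var x)) xs

Pointwise-map⁻ˡ : ∀ {A B C : Set} {R : B → C → Set} {f : A → B} {xs ys} →
                  Pointwise R (map f xs) ys → Pointwise (λ x y → R (f x) y) xs ys
Pointwise-map⁻ˡ {xs = []}     []       = []
Pointwise-map⁻ˡ {xs = _ ∷ _} (r ∷ rs) = r ∷ Pointwise-map⁻ˡ rs

-- The equation s B ≃ expand 𝒜 s B holds for every witness B, atomic or not.
instantiate-expand : {Γ : Ctx n m} (𝒜 : Family n) {s : Tm n m} {B : Ty n} →
                     RP B → Γ ⊢ s ∶ univPoly 𝒜 →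
                     Γ ⊢ tapp s B ≃ expand 𝒜 s B ∶ matrix 𝒜 B
instantiate-expand {Γ = Γ} 𝒜 {s} {B} rB d =
  η-lam* rYs dB (η-In B rB (⊢app*-fresh rYs dB) (≃-castˡ (sym eq) ε-step))
  where
  Ys  = map (_⊃* B) 𝒜
  ys  = map (var ∘ into-scope B) (fresh Ys)
  s′  = ren (into-scope B ∘ weaken Ys) (tren (into-tscope B) s)
  B′  = renᵗ (into-tscope B) B
  Γ′  = Γ ⊞ᶜ Ys

  rYs : All RP Ys
  rYs = RP-⊃*s (RP-univPoly⁻ {𝒜 = 𝒜} (⊢⇒RP d)) rB

  rΓ′ : RPᶜ Γ′
  rΓ′ = RPᶜ-⊞ (⊢⇒RPᶜ d) rYs

  dB : Γ ⊢ tapp s B ∶ matrix 𝒜 B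
  dB = ⊢tapp-univPoly 𝒜 rB d

  s′-eq : into B (ren (weaken Ys) s) ≡ s′
  s′-eq = into-ren B s

  eq : El B [ into B (app* (ren (weaken Ys) (tapp s B)) (map var (fresh Ys))) ] ≡
       El B [ app* (tapp s′ B′) ys ]
  eq = cong (El B [_])
         (trans (into-app* B (ren (weaken Ys) (tapp s B)) (fresh Ys))
                (cong (λ t → app* (tapp t B′) ys) s′-eq))

  ds′ : scopeᶜ B Γ′ ⊢ s′ ∶ univPoly (renᶠ (into-tscope B) 𝒜)
  ds′ = subst₂ (scopeᶜ B Γ′ ⊢_∶_) s′-eq (renᵗ-univPoly (into-tscope B) 𝒜)
          (⊢into B rB (⊢ren-weaken rYs d))

  dy : ∀ {As y} → lookup Γ′ y ≡ As ⊃* B →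
       scopeᶜ B Γ′ ⊢ var (into-scope B y) ∶ map (renᵗ (into-tscope B)) As ⊃* B′
  dy {As} {y} e = ⊢var≡ (RPᶜ-scope rB rΓ′)
    (trans (lookup-into B y)
           (trans (cong (renᵗ (into-tscope B)) e) (hom-⊃* _ (λ _ _ → refl) As B)))

  -- The variables y_k are the arguments u_k of the ε-step.
  dys : Pointwise (λ As u → scopeᶜ B Γ′ ⊢ u ∶ As ⊃* B′) (renᶠ (into-tscope B) 𝒜) ys
  dys = Pointwise.map⁺ _ _ (Pointwise.map (λ {As} → dy {As}) (Pointwise-map⁻ˡ (lookup-fresh Ys)))

  ε-step : scopeᶜ B Γ′ ⊢ El B [ app* (tapp s′ B′) ys ] ≃
             app* (tapp s′ (tvar (at B))) (inside (El B) (renᶠ (into-tscope B) 𝒜) ys)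
             ∶ tvar (at B)
  ε-step = ε (RP-renᵗ (into-tscope B) rB) (tvar (at B)) ds′ dys (⊢El B rB rΓ′)

instantiate-≃ : {Γ : Ctx n m} (𝒜 : Family n) {s : Tm n m} {B : Ty n} →
                RP B → Γ ⊢ s ∶ univPoly 𝒜 →
                Γ ⊢ tapp s B ≃ instantiate 𝒜 s B ∶ matrix 𝒜 B
instantiate-≃ 𝒜 {B = tvar Y} rB d = ≃-refl (⊢tapp-univPoly 𝒜 rB d)
instantiate-≃ 𝒜 {B = _ ⊃ _}  rB d = instantiate-expand 𝒜 rB d
instantiate-≃ 𝒜 {B = ∀∙ _}   rB d = instantiate-expand 𝒜 rB d

proposition15 : ∀ {n m : ℕ} (Γ : Ctx n m) (A : Ty n) (u : Tm n m)
    (d : Γ ⊢ u ∶ A) → Γ ⊢ u ≃ d ↓ᵋ ∶ A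
proposition15 Γ _ _ (⊢var rΓ x) = ≃-refl (⊢var rΓ x)
proposition15 Γ _ _ (⊢lam r d)  = ≃-lam r (proposition15 _ _ _ d)
proposition15 Γ _ _ (⊢app d e)  = ≃-app (proposition15 _ _ _ d) (proposition15 _ _ _ e)
proposition15 Γ _ _ (⊢Lam r d)  = ≃-Lam r (proposition15 _ _ _ d)
proposition15 Γ _ _ (⊢tapp {B = B} r@(univ {𝒜} _) rB d) =
  ≃-trans (≃-tapp r rB ih)
    (≃-cast (sym (matrix-⟦⟧ 𝒜 B)) (instantiate-≃ 𝒜 rB (proj₂ (≃⇒⊢ ih))))
  where
  ih : Γ ⊢ _ ≃ d ↓ᵋ ∶ univPoly 𝒜
  ih = proposition15 _ _ _ d
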